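{- Let $G$ be either the Pappus graph $\mathcal P$ or the Desargues graph $\mathcal D$. Then $G$ is a strongly coherent $\{C_6\}_{P_3}$-ultrahomogeneous graph, where $C_6$ is the cycle on $6$ vertices and $P_3$ is the path on $3$ vertices (regarded as a subgraph of $C_6$).
   Context: All graphs are finite and simple. **The graphs.** The Pappus graph $\mathcal P$ is the cubic graph on vertex set $\mathbb Z_{18}$ obtained from the $18$-cycle $(0,1,\ldots,17)$ by adding the edges $\{1+6x,6+6x\}$, $\{2+6x,9+6x\}$, $\{4+6x,11+6x\}$ for $x\in\{0,1,2\}$ (mod $18$). The Desargues graph $\mathcal D$ is the cubic graph obtained from the $20$-cycle $(0,1,\ldots,19)$, whose vertices $4x,4x+1,4x+2,4x+3$ are renamed $x_0,x_1,x_2,x_3$ respectively ($x\in\mathbb Z_5$), by adding the edges $\{x_3,(x+2)_0\}$ and $\{x_1,(x+2)_2\}$ for $x\in\mathbb Z_5$ (mod $5$). **Definitions.** A copy of a graph $H$ in $G$ is a subgraph of $G$ isomorphic to $H$. For a graph $H$, a graph $G$ is $H$-ultrahomogeneous ($H$-UH) if every isomorphism between two induced copies of $H$ in $G$ extends to an automorphism of $G$. Let $M$ be an induced subgraph of $H$ and let $G$ be both $M$-UH and $H$-UH. Write $H_0\cap H_1=M_0$ to mean $V(H_0)\cap V(H_1)=V(M_0)$ and $E(H_0)\cap E(H_1)=E(M_0)$. $G$ is an $\{H\}_M$-UH graph if, for each copy $H_0$ of $H$ induced in $G$ and each copy $M_0$ of $M$ contained in $H_0$, there exists exactly one copy $H_1\neq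 H_0$ of $H$ induced in $G$ such that $H_0\cap H_1=M_0$. An $\{H\}_M$-UH graph $G$ is $\ell$-coherent $\{H\}_M$-UH if, given a copy $H_0$ of $H$ induced in $G$ and containing a copy $M_0$ of $M$, there exist exactly $\ell$ copies $H_i\neq H_0$ of $H$ induced in $G$ with $H_i\cap H_0\supseteq M_0$ ($i=1,\ldots,\ell$), and (with suitable labelling) $H_1\cap H_0=M_0$. For $|V(H)|>3$ and $M$ a subgraph of $H$, $G$ is strongly coherent $\{H\}_M$-UH if there is a descending sequence of connected subgraphs $M=M_1,M_2,\ldots,M_t\cong K_2$ such that (a) $M_{i+1}$ is obtained from $M_i$ by deleting a vertex, for $i=1,\ldots,t-1$, and (b) $G$ is a $(2^i-1)$-coherent $\{H\}_{M_i}$-UH graph for $i=1,\ldots,t$. -}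

module Defs where

open import Data.Nat using (ℕ; zero; suc; _+_; _*_; _∸_; _^_; _<_)
open import Data.Nat.DivMod using (_mod_)
open import Data.Fin using (Fin; zero; suc; toℕ; fromℕ; inject₁)
import Data.Fin.Properties as Fin
open import Data.Fin.Subset using (Subset; _∈_; _⊆_; _∩_; _-_)
open import Data.Fin.Subset.Properties using (_∈?_; x∈p∩q⁺; x∈p∩q⁻)
open import Data.List using (List; []; _∷_; _++_; map; concatMap; upTo; allFin)
import Data.List.Membership.Propositional as List
import Data.List.Membership.DecPropositional as DecMembership
open import Data.Product using (Σ; Σ-syntax; ∃-syntax; _×_; _,_; proj₁; proj₂)
import Data.Product.Properties as Product
open import Data.Sum using (_⊎_; swap)
open import Function using (_on_)
open import Function.Bundles using (_↔_; _⇔_; Inverse)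
open import Level using (0ℓ)
open import Relation.Binary using (Rel; Symmetric; Irreflexive; Decidable)
open import Relation.Binary.Construct.Closure.ReflexiveTransitive using (Star)
open import Relation.Binary.PropositionalEquality using (_≡_; _≢_; refl; ≢-sym)
open import Relation.Nullary using (¬_)
open import Relation.Nullary.Decidable using (_×-dec_; _⊎-dec_; ¬?)

-- A simple graph on the vertex type V; finite graphs are those on Fin n.
record Graph (V : Set) : Set₁ where
  field
    Adj    : Rel V 0ℓ
    adj?   : Decidable Adj
    symm   : Symmetric Adj
    irrefl : Irreflexive _≡_ Adj

open Graph public

infix 4 _≅_

record _≅_ {V W : Set} (G : Graph V) (H : Graph W) : Set where
  field
    bijection : V ↔ W
  open Inverse bijection public using (to; from)
  field
    adjacency : ∀ {u v} → Adj G u v ⇔ Adj H (to u) (to v)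

Connected : {V : Set} → Graph V → Set
Connected {V} G = V × (∀ u v → Star (Adj G) u v)

-- Each pair stands for an unordered edge; loops are discarded.
fromEdges : ∀ {n} → List (Fin n × Fin n) → Graph (Fin n)
fromEdges {n} es = record
  { Adj    = λ u v → u ≢ v × ((u , v) List.∈ es ⊎ (v , u) List.∈ es)
  ; adj?   = λ u v → ¬? (u Fin.≟ v) ×-dec ((u , v) ∈es? es ⊎-dec (v , u) ∈es? es)
  ; symm   = λ (u≢v , e) → ≢-sym u≢v , swap e
  ; irrefl = λ u≡v (u≢v , _) → u≢v u≡v
  }
  where open DecMembership (Product.≡-dec (Fin._≟_ {n}) (Fin._≟_ {n})) renaming (_∈?_ to _∈es?_)

cycleEdges : ∀ n → List (Fin n × Fin n)
cycleEdges zero      = []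
cycleEdges n@(suc _) = map (λ i → i mod n , suc i mod n) (upTo n)

pathEdges : ∀ n → List (Fin n × Fin n)
pathEdges zero    = []
pathEdges (suc k) = map (λ i → inject₁ i , suc i) (allFin k)

-- C n is the n-cycle only for n ≥ 3.
C : ∀ n → Graph (Fin n)
C n = fromEdges (cycleEdges n)

-- The path on n vertices (not of length n).
P : ∀ n → Graph (Fin n)
P n = fromEdges (pathEdges n)

K : ∀ n → Graph (Fin n)
K n = record
  { Adj    = _≢_
  ; adj?   = λ u v → ¬? (u Fin.≟ v)
  ; symm   = ≢-sym
  ; irrefl = λ u≡v u≢v → u≢v u≡v
  }

𝒫 : Graph (Fin 18)
𝒫 = fromEdges (cycleEdges 18 ++ concatMap chords (upTo 3))
  where
  chords : ℕ → List (Fin 18 × Fin 18)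
  chords x = ((1 + 6 * x) mod 18 , (6 + 6 * x) mod 18)
           ∷ ((2 + 6 * x) mod 18 , (9 + 6 * x) mod 18)
           ∷ ((4 + 6 * x) mod 18 , (11 + 6 * x) mod 18)
           ∷ []

𝒟 : Graph (Fin 20)
𝒟 = fromEdges (cycleEdges 20 ++ concatMap chords (upTo 5))
  where
  -- vertex x i is the vertex x_i. Reducing 4x + i modulo 20 reduces x modulo 5.
  vertex : ℕ → ℕ → Fin 20
  vertex x i = (4 * x + i) mod 20

  chords : ℕ → List (Fin 20 × Fin 20)
  chords x = (vertex x 3 , vertex (x + 2) 0)
           ∷ (vertex x 1 , vertex (x + 2) 2)
           ∷ []

-- An edge {u , v} is recorded as v ∈ edges u (equivalently u ∈ edges v).
record Subgraph {n} (G : Graph (Fin n)) : Set where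
  field
    vertices   : Subset n
    edges      : Fin n → Subset n
    edges-sym  : ∀ {u v} → v ∈ edges u → u ∈ edges v
    edges-adj  : ∀ {u v} → v ∈ edges u → Adj G u v
    edges-ends : ∀ {u v} → v ∈ edges u → u ∈ vertices

open Subgraph public

module _ {n} {G : Graph (Fin n)} where

  -- A subgraph as a graph in its own right.
  ⟦_⟧ : (S : Subgraph G) → Graph (Σ[ v ∈ Fin n ] v ∈ vertices S)
  ⟦ S ⟧ = record
    { Adj    = (λ u v → v ∈ edges S u) on proj₁
    ; adj?   = λ (u , _) (v , _) → v ∈? edges S u
    ; symm   = edges-sym S
    ; irrefl = λ { refl e → irrefl G refl (edges-adj S e) }
    }

  infix 4 _≈_ _⊑_
  infixr 7 _⊓_

  -- Equality of subgraphs, ignoring the proof fields.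
  _≈_ : Rel (Subgraph G) 0ℓ
  S ≈ T = vertices S ≡ vertices T × (∀ u → edges S u ≡ edges T u)

  _⊑_ : Rel (Subgraph G) 0ℓ
  S ⊑ T = vertices S ⊆ vertices T × (∀ u → edges S u ⊆ edges T u)

  _⊓_ : Subgraph G → Subgraph G → Subgraph G
  S ⊓ T = record
    { vertices   = vertices S ∩ vertices T
    ; edges      = λ u → edges S u ∩ edges T u
    ; edges-sym  = λ e → let s , t = x∈p∩q⁻ _ _ e in x∈p∩q⁺ (edges-sym S s , edges-sym T t)
    ; edges-adj  = λ e → edges-adj S (proj₁ (x∈p∩q⁻ _ _ e))
    ; edges-ends = λ e → let s , t = x∈p∩q⁻ _ _ e in x∈p∩q⁺ (edges-ends S s , edges-ends T t)
    }

  Induced : Subgraph G → Set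
  Induced S = ∀ {u v} → u ∈ vertices S → v ∈ vertices S → Adj G u v → v ∈ edges S u

  IsCopy : {W : Set} → Graph W → Subgraph G → Set
  IsCopy H S = ⟦ S ⟧ ≅ H

  IsInducedCopy : {W : Set} → Graph W → Subgraph G → Set
  IsInducedCopy H S = Induced S × IsCopy H S

  DeletesVertex : Subgraph G → Fin n → Subgraph G → Set
  DeletesVertex S x T =
    x ∈ vertices S ×
    vertices T ≡ vertices S - x ×
    (∀ {u v} → v ∈ edges T u ⇔ (v ∈ edges S u × u ≢ x × v ≢ x))

  Extends : {X Y : Subgraph G} → G ≅ G → ⟦ X ⟧ ≅ ⟦ Y ⟧ → Set
  Extends α φ = ∀ x → _≅_.to α (proj₁ x) ≡ proj₁ (_≅_.to φ x)

  -- Exactly ℓ subgraphs, up to _≈_, satisfy Q.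
  record Exactly (ℓ : ℕ) (Q : Subgraph G → Set) : Set where
    field
      member   : Fin ℓ → Subgraph G
      sound    : ∀ i → Q (member i)
      distinct : ∀ {i j} → member i ≈ member j → i ≡ j
      complete : ∀ S → Q S → ∃[ i ] S ≈ member i

UH : ∀ {n} {W : Set} → Graph (Fin n) → Graph W → Set
UH G H = ∀ (X Y : Subgraph G) → IsInducedCopy H X → IsInducedCopy H Y →
         (φ : ⟦ X ⟧ ≅ ⟦ Y ⟧) → Σ[ α ∈ G ≅ G ] Extends {X = X} {Y = Y} α φ

module _ {n m} (G : Graph (Fin n)) (H : Graph (Fin m)) where

  -- “G is an {H}_M-UH graph”.
  record RelativelyUH (M : Subgraph H) : Set where
    field
      M-induced : Induced M
      M-UH      : UH G ⟦ M ⟧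
      H-UH      : UH G H
      unique    : ∀ (H₀ M₀ : Subgraph G) → IsInducedCopy H H₀ → IsCopy ⟦ M ⟧ M₀ → M₀ ⊑ H₀ →
                  Exactly 1 (λ H₁ → IsInducedCopy H H₁ × ¬ (H₁ ≈ H₀) × (H₀ ⊓ H₁) ≈ M₀)

  -- “G is an ℓ-coherent {H}_M-UH graph”; the index i in `coherent` plays the role
  -- of the label 1.
  record Coherent (ℓ : ℕ) (M : Subgraph H) : Set where
    field
      relativelyUH : RelativelyUH M
      coherent     : ∀ (H₀ M₀ : Subgraph G) → IsInducedCopy H H₀ → IsCopy ⟦ M ⟧ M₀ → M₀ ⊑ H₀ →
                     Σ[ E ∈ Exactly ℓ (λ Hᵢ → IsInducedCopy H Hᵢ × ¬ (Hᵢ ≈ H₀) × M₀ ⊑ (Hᵢ ⊓ H₀)) ]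
                     ∃[ i ] (Exactly.member E i ⊓ H₀) ≈ M₀

  -- The sequence M₁, …, M_t is indexed from zero, with t = suc k: the entry at i
  -- is M_{i+1}, whence the exponent in `coherent`.
  record StronglyCoherent (M : Subgraph H) : Set where
    field
      order>3   : 3 < m
      k         : ℕ
      chain     : Fin (suc k) → Subgraph H
      first     : chain zero ≈ M
      last      : ⟦ chain (fromℕ k) ⟧ ≅ K 2
      connected : ∀ i → Connected ⟦ chain i ⟧
      deletion  : ∀ (i : Fin k) → ∃[ x ] DeletesVertex (chain (inject₁ i)) x (chain (suc i))
      coherent  : ∀ i → Coherent (2 ^ suc (toℕ i) ∸ 1) (chain i)

{-# OPTIONS --safe #-}
module Submission where

-- Both graphs are 3-arc-transitive: generators realise every continuation of the initial segments of
-- the arc 0123, a flip of the edge 01 makes the graph vertex-transitive along its Hamiltonian path,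
-- and the arc stabilisers then give 3-arcs. Each 3-arc lies in a unique hexagon, so edges, 2-paths and
-- hexagons are all ultrahomogeneous. Since there are no triangles, copies of K₂ and P₃ are induced, hence
-- all subgraphs involved are determined by their vertex sets, and coherence becomes a count in the list
-- of hexagons: an edge lies in four of them and a 2-path in two. Each finite condition is decided by
-- evaluation.

open import Defs
open import Data.Bool using (true)
import Data.Bool.Properties as Bool
open import Data.Fin using (Fin; zero; suc; toℕ; inject₁; #_)
open import Data.Fin.Induction using (<-weakInduction)
import Data.Fin.Properties as Fin
open import Data.Fin.Properties using (all?; any?; suc-injective)
open import Data.Fin.Subset using (Subset; _∈_; _⊆_; _∩_; _-_)
open import Data.Fin.Subset.Properties
  using (_∈?_; _⊆?_; ⊆-antisym; ⊆-reflexive; ∩-comm; x∈p∩q⁺; x∈p∩q⁻; x∈p∧x≢y⇒x∈p-y; p─q⊆p)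
open import Data.List using (List; []; _∷_; length; filter; allFin)
import Data.List as List
open import Data.List.Membership.Propositional.Properties using (∈-filter⁺; ∈-filter⁻; ∈-allFin; ∈-lookup)
open import Data.List.Relation.Unary.AllPairs using ([]; _∷_)
import Data.List.Relation.Unary.All as All
open import Data.List.Relation.Unary.Any using (index)
open import Data.List.Relation.Unary.Any.Properties using (lookup-index)
open import Data.List.Relation.Unary.Unique.Propositional using (Unique)
open import Data.List.Relation.Unary.Unique.Propositional.Properties using (filter⁺; allFin⁺)
open import Data.Nat using (ℕ; suc; _+_; s≤s; z≤n)
import Data.Nat as ℕ
open import Data.Nat.DivMod using (_mod_)
open import Data.Product using (Σ; Σ-syntax; ∃-syntax; _×_; _,_; proj₁; proj₂)
open import Data.Sum using (_⊎_; inj₁; inj₂)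
open import Data.Vec using (Vec; []; _∷_; lookup; tabulate)
import Data.Vec as Vec
import Data.Vec.Properties as Vec
open import Data.Vec.Properties.WithK using ([]=-irrelevant)
open import Function using (_∘_; id)
open import Function.Bundles using (_⇔_; mk⇔; mk↔ₛ′; Equivalence; Inverse)
open import Function.Properties.Inverse using (↔-sym; ↔-trans)
open import Level using (0ℓ)
open import Relation.Binary.Construct.Closure.ReflexiveTransitive using (Star; ε; _◅_; _◅◅_; gmap; reverse)
open import Relation.Binary.PropositionalEquality
  using (_≡_; _≢_; refl; sym; trans; cong; cong₂; subst; subst₂)
open import Relation.Nullary using (¬_; Dec; does; invert; proof; Reflects; contradiction)
open import Relation.Nullary.Decidable using (map′; dec-true; from-yes; _×-dec_; _⊎-dec_; _→-dec_; ¬?)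
open import Relation.Unary using (Pred; Decidable)

open _≅_ using (to; from; bijection; adjacency)
open Equivalence using () renaming (to to to⇒; from to from⇒)

private
  variable
    V W X : Set
    m n : ℕ

-- Isomorphisms, automorphisms and connectedness

module _ {G : Graph V} {H : Graph W} (φ : G ≅ H) where

  to∘from : ∀ w → to φ (from φ w) ≡ w
  to∘from = Inverse.strictlyInverseˡ (bijection φ)

  from∘to : ∀ v → from φ (to φ v) ≡ v
  from∘to = Inverse.strictlyInverseʳ (bijection φ)

  from-injective : ∀ {x y} → from φ x ≡ from φ y → x ≡ y
  from-injective {x} {y} eq = trans (sym (to∘from x)) (trans (cong (to φ) eq) (to∘from y))

  to-adj : ∀ {u v} → Adj G u v → Adj H (to φ u) (to φ v)
  to-adj = to⇒ (adjacency φ)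

  from-adj : ∀ {u v} → Adj H u v → Adj G (from φ u) (from φ v)
  from-adj {u} {v} e = from⇒ (adjacency φ) (subst₂ (Adj H) (sym (to∘from u)) (sym (to∘from v)) e)

≅-sym : {G : Graph V} {H : Graph W} → G ≅ H → H ≅ G
≅-sym {H = H} φ = record
  { bijection = ↔-sym (bijection φ)
  ; adjacency = mk⇔ (from-adj φ) (λ e → subst₂ (Adj H) (to∘from φ _) (to∘from φ _) (to-adj φ e))
  }

≅-trans : {G : Graph V} {H : Graph W} {I : Graph X} → G ≅ H → H ≅ I → G ≅ I
≅-trans φ ψ = record
  { bijection = ↔-trans (bijection φ) (bijection ψ)
  ; adjacency = mk⇔ (to-adj ψ ∘ to-adj φ) (from⇒ (adjacency φ) ∘ from⇒ (adjacency ψ))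
  }

-- Applying `f` to the image of an edge returns the edge, so preserving adjacency already forces
-- reflecting it.
involution : (G : Graph V) (f : V → V) → (∀ v → f (f v) ≡ v) →
             (∀ u v → Adj G u v → Adj G (f u) (f v)) → G ≅ G
involution G f invol pres = record
  { bijection = mk↔ₛ′ f f invol invol
  ; adjacency = λ {u} {v} → mk⇔ (pres u v) (subst₂ (Adj G) (invol u) (invol v) ∘ pres (f u) (f v))
  }

≅-connected : {G : Graph V} {H : Graph W} → G ≅ H → Connected H → Connected G
≅-connected φ (w , path) = from φ w , λ u v →
  subst₂ (Star _) (from∘to φ u) (from∘to φ v) (gmap (from φ) (from-adj φ) (path (to φ u) (to φ v)))

dominated-connected : (G : Graph V) (h : V) → (∀ u → u ≡ h ⊎ Adj G u h) → Connected G
dominated-connected G h dom = h , λ u v → path u ◅◅ reverse (symm G) (path v)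
  where
  path : ∀ u → Star (Adj G) u h
  path u with dom u
  ... | inj₁ refl = ε
  ... | inj₂ e    = e ◅ ε

-- Embeddings, decidable subsets and images

record Embedding {V W : Set} (H : Graph W) (G : Graph V) (f : W → V) : Set where
  field
    injective : ∀ {i j} → f i ≡ f j → i ≡ j
    preserves : ∀ {i j} → Adj H i j → Adj G (f i) (f j)

open Embedding

distinct : {H : Graph W} {G : Graph V} {f : W → V} → Embedding H G f →
           ∀ {i j} → i ≢ j → f i ≢ f j
distinct emb i≢j eq = i≢j (injective emb eq)

select : {P : Pred (Fin n) 0ℓ} → Decidable P → Subset n
select P? = tabulate (does ∘ P?)

module _ {P : Pred (Fin n) 0ℓ} (P? : Decidable P) where

  ∈-select⁺ : ∀ {v} → P v → v ∈ select P?
  ∈-select⁺ {v} p = Vec.lookup⇒[]= v _ (trans (Vec.lookup∘tabulate _ v) (dec-true (P? v) p))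

  ∈-select⁻ : ∀ {v} → v ∈ select P? → P v
  ∈-select⁻ {v} v∈ = invert (subst (Reflects (P v)) does≡true (proof (P? v)))
    where
    does≡true : does (P? v) ≡ true
    does≡true = trans (sym (Vec.lookup∘tabulate _ v)) (Vec.[]=⇒lookup v∈)

inImage? : (f : Fin m → Fin n) → Decidable (λ v → ∃[ i ] f i ≡ v)
inImage? f v = any? (λ i → f i Fin.≟ v)

image : (Fin m → Fin n) → Subset n
image f = select (inImage? f)

∈-image⁺ : (f : Fin m → Fin n) (i : Fin m) → f i ∈ image f
∈-image⁺ f i = ∈-select⁺ (inImage? f) (i , refl)

∈-image⁻ : (f : Fin m → Fin n) {v : Fin n} → v ∈ image f → ∃[ i ] f i ≡ v
∈-image⁻ f = ∈-select⁻ (inImage? f)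

x∈p-y⇒x≢y : (p : Subset n) {x y : Fin n} → y ∈ p - x → y ≢ x
x∈p-y⇒x≢y (_ ∷ p) {zero}  (Vec.there _)   ()
x∈p-y⇒x≢y (_ ∷ p) {suc x} Vec.here        ()
x∈p-y⇒x≢y (_ ∷ p) {suc x} (Vec.there y∈p) refl = x∈p-y⇒x≢y p y∈p refl

-- Membership proofs in a `Subset` are unique, so vertices of `⟦ S ⟧` may be compared in `Fin n`.
∈-ext : {p : Subset n} {x y : Σ[ v ∈ Fin n ] v ∈ p} → proj₁ x ≡ proj₁ y → x ≡ y
∈-ext {x = v , p} {y = .v , q} refl = cong (v ,_) ([]=-irrelevant p q)

-- Subgraphs, inducedness and copies

module _ {G : Graph (Fin n)} where

  ≈-sym : {S T : Subgraph G} → S ≈ T → T ≈ S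
  ≈-sym (p , q) = sym p , sym ∘ q

  ≈-trans : {S T U : Subgraph G} → S ≈ T → T ≈ U → S ≈ U
  ≈-trans (p , q) (p′ , q′) = trans p p′ , λ u → trans (q u) (q′ u)

  edges-ends′ : (S : Subgraph G) → ∀ {u v} → v ∈ edges S u → v ∈ vertices S
  edges-ends′ S = edges-ends S ∘ edges-sym S

  module _ {S T : Subgraph G} where

    Induced⇒⊑ : Induced T → vertices S ⊆ vertices T → S ⊑ T
    Induced⇒⊑ indT S⊆T = S⊆T , λ u e →
      indT (S⊆T (edges-ends S e)) (S⊆T (edges-ends′ S e)) (edges-adj S e)

    Induced-⊓ : Induced S → Induced T → Induced (S ⊓ T)
    Induced-⊓ indS indT u∈ v∈ e =
      let uS , uT = x∈p∩q⁻ _ _ u∈ ; vS , vT = x∈p∩q⁻ _ _ v∈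
      in x∈p∩q⁺ (indS uS vS e , indT uT vT e)

  Induced⇒≈ : {S T : Subgraph G} → Induced S → Induced T → vertices S ≡ vertices T → S ≈ T
  Induced⇒≈ {S} {T} indS indT eq = eq , λ u →
    ⊆-antisym (proj₂ (Induced⇒⊑ {S} {T} indT (⊆-reflexive eq)) u)
              (proj₂ (Induced⇒⊑ {T} {S} indS (⊆-reflexive (sym eq))) u)

  module _ {H : Graph (Fin m)} (S : Subgraph G) where

    copyOf : (f : Fin m → Fin n) → (∀ {i j} → f i ≡ f j → i ≡ j) →
             (∀ i → f i ∈ vertices S) → (∀ {v} → v ∈ vertices S → ∃[ i ] f i ≡ v) →
             (∀ {i j} → Adj H i j ⇔ f j ∈ edges S (f i)) → IsCopy H S
    copyOf f inj into onto adj = ≅-sym record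
      { bijection = mk↔ₛ′ (λ i → f i , into i) (λ (_ , v∈) → proj₁ (onto v∈))
                          (λ (_ , v∈) → ∈-ext (proj₂ (onto v∈))) (λ i → inj (proj₂ (onto (into i))))
      ; adjacency = adj
      }

    module _ (φ : IsCopy H S) where

      point : Fin m → Fin n
      point i = proj₁ (from φ i)

      point-to : ∀ {v} (v∈ : v ∈ vertices S) → point (to φ (v , v∈)) ≡ v
      point-to v∈ = cong proj₁ (from∘to φ (_ , v∈))

      point∈ : ∀ i → point i ∈ vertices S
      point∈ i = proj₂ (from φ i)

      point-embedding : Embedding H G point
      point-embedding = record
        { injective = from-injective φ ∘ ∈-ext
        ; preserves = edges-adj S ∘ from-adj φ
        }

      vertices≡image : vertices S ≡ image point
      vertices≡image = ⊆-antisym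
        (λ v∈ → subst (_∈ image point) (point-to v∈) (∈-image⁺ point _))
        (λ v∈ → let i , eq = ∈-image⁻ point v∈ in subst (_∈ vertices S) eq (point∈ i))

      -- An edge of `G` between two points is pulled back to an edge of `H`, and the isomorphism
      -- puts every edge of `H` into `S`.
      copy-Induced : (∀ i j → Adj G (point i) (point j) → Adj H i j) → Induced S
      copy-Induced refl-adj {u} {v} u∈ v∈ e = from⇒ (adjacency φ)
        (refl-adj _ _ (subst₂ (Adj G) (sym (point-to u∈)) (sym (point-to v∈)) e))

-- Ultrahomogeneity from transitivity on embeddings

module _ (G : Graph (Fin n)) where

  inducedEdge? : (p : Subset n) (u : Fin n) → Decidable (λ v → u ∈ p × v ∈ p × Adj G u v)
  inducedEdge? p u v = u ∈? p ×-dec v ∈? p ×-dec adj? G u v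

  induced : Subset n → Subgraph G
  induced p = record
    { vertices   = p
    ; edges      = λ u → select (inducedEdge? p u)
    ; edges-sym  = λ e → let u∈ , v∈ , a = ∈-select⁻ (inducedEdge? p _) e
                         in ∈-select⁺ (inducedEdge? p _) (v∈ , u∈ , symm G a)
    ; edges-adj  = λ e → proj₂ (proj₂ (∈-select⁻ (inducedEdge? p _) e))
    ; edges-ends = λ e → proj₁ (∈-select⁻ (inducedEdge? p _) e)
    }

  induced-Induced : (p : Subset n) → Induced (induced p)
  induced-Induced p u∈ v∈ e = ∈-select⁺ (inducedEdge? p _) (u∈ , v∈ , e)

  image-IsInducedCopy : {H : Graph (Fin m)} {f : Fin m → Fin n} → Embedding H G f →
                        (∀ i j → Adj G (f i) (f j) → Adj H i j) → IsInducedCopy H (induced (image f))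
  image-IsInducedCopy {f = f} emb reflects =
    induced-Induced (image f) ,
    copyOf (induced (image f)) f (injective emb) (∈-image⁺ f) (∈-image⁻ f)
      (mk⇔ (λ a → induced-Induced (image f) (∈-image⁺ f _) (∈-image⁺ f _) (preserves emb a))
           (λ e → reflects _ _ (edges-adj (induced (image f)) e)))

  -- Both copies are parametrised by embeddings of `H`, and automorphisms α and β carry `base` to
  -- these two embeddings. Then α⁻¹ followed by β extends φ, provided the two parametrisations
  -- correspond under φ.
  embeddings-transitive⇒UH :
    {H : Graph (Fin m)} (base : Fin m → Fin n) →
    (∀ f → Embedding H G f → Σ[ α ∈ G ≅ G ] (∀ i → to α (base i) ≡ f i)) → UH G H
  embeddings-transitive⇒UH base reach X Y (_ , cX) _ φ = ≅-trans (≅-sym α) β , extends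
    where
    -- This choice makes the parametrisation of `Y` equal to that of `X` followed by φ; the copy
    -- structure supplied with `Y` could differ from it by a symmetry of `H`.
    cY = ≅-trans (≅-sym φ) cX
    open Σ (reach _ (point-embedding X cX)) renaming (proj₁ to α; proj₂ to α-base)
    open Σ (reach _ (point-embedding Y cY)) renaming (proj₁ to β; proj₂ to β-base)

    extends : ∀ x → to β (from α (proj₁ x)) ≡ proj₁ (to φ x)
    extends x = trans (cong (to β) α⁻¹x) (trans (β-base i) (cong (proj₁ ∘ to φ) (from∘to cX x)))
      where
      i = to cX x
      α⁻¹x : from α (proj₁ x) ≡ base i
      α⁻¹x = trans (cong (from α) (trans (sym (cong proj₁ (from∘to cX x))) (sym (α-base i))))
                   (from∘to α (base i))

  UH-resp-≅ : {H : Graph V} {I : Graph W} → H ≅ I → UH G I → UH G H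
  UH-resp-≅ ψ uh X Y (iX , cX) (iY , cY) = uh X Y (iX , ≅-trans cX ψ) (iY , ≅-trans cY ψ)

-- Counting subgraphs in a finite family

lookup-injective : {A : Set} {xs : List A} → Unique xs →
                   ∀ {i j} → List.lookup xs i ≡ List.lookup xs j → i ≡ j
lookup-injective (_  ∷ _) {zero}  {zero}  _  = refl
lookup-injective (x∉ ∷ _) {zero}  {suc j} eq = contradiction eq (All.lookup x∉ (∈-lookup j))
lookup-injective (x∉ ∷ _) {suc i} {zero}  eq = contradiction (sym eq) (All.lookup x∉ (∈-lookup i))
lookup-injective (_  ∷ u) {suc i} {suc j} eq = cong suc (lookup-injective u eq)

module _ {G : Graph (Fin n)} {N : ℕ} (family : Fin N → Subgraph G)
         (distinct : ∀ {i j} → family i ≈ family j → i ≡ j) where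

  -- The members are the entries of the filtered index list, and matching the length equation with
  -- `refl` turns `Fin ℓ` into the positions of that list. Filtering keeps `allFin N` free of
  -- duplicates, so distinct positions give distinct subgraphs.
  filtered-Exactly : {Q : Subgraph G → Set} {R : Pred (Fin N) 0ℓ} (R? : Decidable R) {ℓ : ℕ} →
                     length (filter R? (allFin N)) ≡ ℓ → (∀ j → R j → Q (family j)) →
                     (∀ S → Q S → ∃[ j ] R j × S ≈ family j) → Exactly ℓ Q
  filtered-Exactly R? refl sound complete = record
    { member   = λ i → family (List.lookup hits i)
    ; sound    = λ i → sound _ (proj₂ (∈-filter⁻ R? {xs = allFin N} (∈-lookup i)))
    ; distinct = lookup-injective (filter⁺ R? (allFin⁺ N)) ∘ distinct
    ; complete = λ S q → let j , r , S≈j = complete S q ; j∈ = ∈-filter⁺ R? (∈-allFin j) r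
                         in index j∈ , subst (λ k → S ≈ family k) (lookup-index j∈) S≈j
    }
    where hits = filter R? (allFin N)

-- Edges and 2-paths in triangle-free graphs

TriangleFree : Graph V → Set
TriangleFree G = ∀ u v → Adj G u v → ∀ w → Adj G v w → ¬ Adj G u w

P₃-edge₀₁ : Adj (P 3) (# 0) (# 1)
P₃-edge₀₁ = from-yes (adj? (P 3) (# 0) (# 1))

P₃-edge₁₂ : Adj (P 3) (# 1) (# 2)
P₃-edge₁₂ = from-yes (adj? (P 3) (# 1) (# 2))

module _ {G : Graph V} where

  K₂-reflects : {f : Fin 2 → V} → ∀ i j → Adj G (f i) (f j) → Adj (K 2) i j
  K₂-reflects i j e i≡j = irrefl G (cong _ i≡j) e

  -- The two ends are the only distinct indices that are not adjacent, and an edge between their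
  -- images would close a triangle.
  P₃-reflects : {f : Fin 3 → V} → TriangleFree G → Embedding (P 3) G f →
                ∀ i j → Adj G (f i) (f j) → Adj (P 3) i j
  P₃-reflects {f} free emb = reflects
    where
    f₀f₁ : Adj G (f (# 0)) (f (# 1))
    f₀f₁ = preserves emb P₃-edge₀₁
    f₁f₂ : Adj G (f (# 1)) (f (# 2))
    f₁f₂ = preserves emb P₃-edge₁₂

    reflects : ∀ i j → Adj G (f i) (f j) → Adj (P 3) i j
    reflects zero             zero             e = contradiction e (irrefl G refl)
    reflects zero             (suc zero)       e = P₃-edge₀₁
    reflects zero             (suc (suc zero)) e = contradiction e (free _ _ f₀f₁ _ f₁f₂)
    reflects (suc zero)       zero             e = symm (P 3) P₃-edge₀₁
    reflects (suc zero)       (suc zero)       e = contradiction e (irrefl G refl)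
    reflects (suc zero)       (suc (suc zero)) e = P₃-edge₁₂
    reflects (suc (suc zero)) zero             e = contradiction (symm G e) (free _ _ f₀f₁ _ f₁f₂)
    reflects (suc (suc zero)) (suc zero)       e = symm (P 3) P₃-edge₁₂
    reflects (suc (suc zero)) (suc (suc zero)) e = contradiction e (irrefl G refl)

-- Finite conditions and their decision procedures

record Neighbours (G : Graph (Fin n)) : Set where
  field
    nbr     : Fin n → Fin 3 → Fin n
    nbr-adj : ∀ u k → Adj G u (nbr u k)
    adj-nbr : ∀ u v → Adj G u v → ∃[ k ] nbr u k ≡ v

  -- Much cheaper to evaluate than adj? G.
  _~?_ : ∀ u v → Dec (Adj G u v)
  u ~? v = map′ (λ (k , eq) → subst (Adj G u) eq (nbr-adj u k)) (adj-nbr u v)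
                (any? (λ k → nbr u k Fin.≟ v))

  -- Three cases replace a quantifier over all vertices. The conditions below interleave quantifiers
  -- with adjacencies, so that a search over walks branches threefold at each step.
  all-nbr? : ∀ u {P : Pred (Fin n) 0ℓ} → Decidable P → Dec (∀ v → Adj G u v → P v)
  all-nbr? u {P} P? = map′ (λ h v e → let k , eq = adj-nbr u v e in subst P eq (h k))
                           (λ h k → h _ (nbr-adj u k)) (all? (P? ∘ nbr u))

module Conditions (G : Graph (Fin (4 + n))) {N r : ℕ}
                  (hexagon : Fin (suc N) → Fin 6 → Fin (4 + n))
                  (generator : Fin r → Fin (4 + n) → Fin (4 + n)) where

  Vertex : Set
  Vertex = Fin (4 + n)

  v₀ v₁ v₂ v₃ : Vertex
  v₀ = zero
  v₁ = suc zero
  v₂ = suc (suc zero)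
  v₃ = suc (suc (suc zero))

  hexSet : Fin (suc N) → Subset (4 + n)
  hexSet j = image (hexagon j)

  Consecutive GeneratorsInvolutive GeneratorsPreserve Flip Fan₁ Fan₂ Fan₃ : Set
  Consecutive          = ∀ i → Adj G (inject₁ i) (suc i)
  GeneratorsInvolutive = ∀ g v → generator g (generator g v) ≡ v
  GeneratorsPreserve   = ∀ g u v → Adj G u v → Adj G (generator g u) (generator g v)
  Flip = ∃[ g ] generator g v₀ ≡ v₁
  Fan₁ = ∀ v → Adj G v₀ v → ∃[ g ] generator g v₀ ≡ v₀ × generator g v₁ ≡ v
  Fan₂ = ∀ v → Adj G v₁ v → v ≢ v₀ →
         ∃[ g ] generator g v₀ ≡ v₀ × generator g v₁ ≡ v₁ × generator g v₂ ≡ v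
  Fan₃ = ∀ v → Adj G v₂ v → v ≢ v₁ →
         ∃[ g ] generator g v₀ ≡ v₀ × generator g v₁ ≡ v₁ × generator g v₂ ≡ v₂ × generator g v₃ ≡ v

  HexagonsInjective HexagonsPreserve HexagonsReflect HexagonsDistinct HexagonsComplete ArcExtends : Set
  HexagonsInjective = ∀ j i k → hexagon j i ≡ hexagon j k → i ≡ k
  HexagonsPreserve  = ∀ j i k → Adj (C 6) i k → Adj G (hexagon j i) (hexagon j k)
  HexagonsReflect   = ∀ j i k → Adj G (hexagon j i) (hexagon j k) → Adj (C 6) i k
  HexagonsDistinct  = ∀ i j → hexSet i ≡ hexSet j → i ≡ j
  -- A hexagon enters as a closed walk. Requiring each new vertex to differ from the one two steps
  -- back prunes the search early, and comparing vertex sets removes the choice of starting point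
  -- and direction.
  HexagonsComplete  =
    ∀ a b → Adj G a b → ∀ c → Adj G b c → c ≢ a → ∀ d → Adj G c d → d ≢ b →
    ∀ e → Adj G d e → e ≢ c → ∀ f → Adj G e f → f ≢ d → Adj G f a →
    ∃[ j ] image (lookup (a ∷ b ∷ c ∷ d ∷ e ∷ f ∷ [])) ≡ hexSet j
  -- Uniqueness of the hexagon on the 3-arc `v₀ v₁ v₂ v₃`: it must be the one listed first,
  -- traversed in this order.
  ArcExtends =
    ∀ x → Adj G v₃ x → x ≢ v₂ → ∀ y → Adj G x y → Adj G y v₀ →
    ∀ i → lookup (v₀ ∷ v₁ ∷ v₂ ∷ v₃ ∷ x ∷ y ∷ []) i ≡ hexagon zero i

  Through MeetsIn : Subset (4 + n) → Fin (suc N) → Fin (suc N) → Set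
  Through p i j = j ≢ i × p ⊆ hexSet j
  MeetsIn p i j = j ≢ i × hexSet i ∩ hexSet j ≡ p

  through? : ∀ p i → Decidable (Through p i)
  through? p i j = ¬? (j Fin.≟ i) ×-dec p ⊆? hexSet j

  meetsIn? : ∀ p i → Decidable (MeetsIn p i)
  meetsIn? p i j = ¬? (j Fin.≟ i) ×-dec Vec.≡-dec Bool._≟_ (hexSet i ∩ hexSet j) p

  -- The first count gives the ℓ further copies of ℓ-coherence, the second the unique H₁ of relative
  -- ultrahomogeneity.
  Incidence : ℕ → Subset (4 + n) → Set
  Incidence ℓ p = ∀ i → p ⊆ hexSet i →
    length (filter (through? p i) (allFin (suc N))) ≡ ℓ ×
    length (filter (meetsIn? p i) (allFin (suc N))) ≡ 1

  EdgeIncidence PathIncidence : Set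
  EdgeIncidence = ∀ a b → Adj G a b → Incidence 3 (image (lookup (a ∷ b ∷ [])))
  PathIncidence = ∀ a b → Adj G a b → ∀ c → Adj G b c → c ≢ a →
                  Incidence 1 (image (lookup (a ∷ b ∷ c ∷ [])))

  module Deciders (nbrs : Neighbours G) where

    open Neighbours nbrs

    triangleFree? : Dec (TriangleFree G)
    triangleFree? = all? λ u → all-nbr? u λ v → all-nbr? v λ w → ¬? (u ~? w)

    consecutive? : Dec Consecutive
    consecutive? = all? λ i → inject₁ i ~? suc i

    generatorsInvolutive? : Dec GeneratorsInvolutive
    generatorsInvolutive? = all? λ g → all? λ v → generator g (generator g v) Fin.≟ v

    generatorsPreserve? : Dec GeneratorsPreserve
    generatorsPreserve? = all? λ g → all? λ u → all-nbr? u λ v → generator g u ~? generator g v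

    flip? : Dec Flip
    flip? = any? λ g → generator g v₀ Fin.≟ v₁

    fan₁? : Dec Fan₁
    fan₁? = all-nbr? v₀ λ v → any? λ g → generator g v₀ Fin.≟ v₀ ×-dec generator g v₁ Fin.≟ v

    fan₂? : Dec Fan₂
    fan₂? = all-nbr? v₁ λ v → ¬? (v Fin.≟ v₀) →-dec
      any? λ g → generator g v₀ Fin.≟ v₀ ×-dec generator g v₁ Fin.≟ v₁ ×-dec generator g v₂ Fin.≟ v

    fan₃? : Dec Fan₃
    fan₃? = all-nbr? v₂ λ v → ¬? (v Fin.≟ v₁) →-dec
      any? λ g → generator g v₀ Fin.≟ v₀ ×-dec generator g v₁ Fin.≟ v₁ ×-dec
                 generator g v₂ Fin.≟ v₂ ×-dec generator g v₃ Fin.≟ v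

    hexagonsInjective? : Dec HexagonsInjective
    hexagonsInjective? = all? λ j → all? λ i → all? λ k →
      (hexagon j i Fin.≟ hexagon j k) →-dec (i Fin.≟ k)

    hexagonsPreserve? : Dec HexagonsPreserve
    hexagonsPreserve? = all? λ j → all? λ i → all? λ k →
      adj? (C 6) i k →-dec (hexagon j i ~? hexagon j k)

    hexagonsReflect? : Dec HexagonsReflect
    hexagonsReflect? = all? λ j → all? λ i → all? λ k →
      (hexagon j i ~? hexagon j k) →-dec adj? (C 6) i k

    hexagonsDistinct? : Dec HexagonsDistinct
    hexagonsDistinct? = all? λ i → all? λ j → Vec.≡-dec Bool._≟_ (hexSet i) (hexSet j) →-dec (i Fin.≟ j)

    hexagonsComplete? : Dec HexagonsComplete
    hexagonsComplete? =
      all? λ a → all-nbr? a λ b → all-nbr? b λ c → ¬? (c Fin.≟ a) →-dec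
      (all-nbr? c λ d → ¬? (d Fin.≟ b) →-dec (all-nbr? d λ e → ¬? (e Fin.≟ c) →-dec
      (all-nbr? e λ f → ¬? (f Fin.≟ d) →-dec ((f ~? a) →-dec
      any? λ j → Vec.≡-dec Bool._≟_ (image (lookup (a ∷ b ∷ c ∷ d ∷ e ∷ f ∷ []))) (hexSet j)))))

    arcExtends? : Dec ArcExtends
    arcExtends? = all-nbr? v₃ λ x → ¬? (x Fin.≟ v₂) →-dec
      (all-nbr? x λ y → (y ~? v₀) →-dec
      all? λ i → lookup (v₀ ∷ v₁ ∷ v₂ ∷ v₃ ∷ x ∷ y ∷ []) i Fin.≟ hexagon zero i)

    incidence? : ∀ ℓ → Decidable (Incidence ℓ)
    incidence? ℓ p = all? λ i → (p ⊆? hexSet i) →-dec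
      ((length (filter (through? p i) (allFin (suc N))) ℕ.≟ ℓ) ×-dec
       (length (filter (meetsIn? p i) (allFin (suc N))) ℕ.≟ 1))

    edgeIncidence? : Dec EdgeIncidence
    edgeIncidence? = all? λ a → all-nbr? a λ b → incidence? 3 (image (lookup (a ∷ b ∷ [])))

    pathIncidence? : Dec PathIncidence
    pathIncidence? = all? λ a → all-nbr? a λ b → all-nbr? b λ c → ¬? (c Fin.≟ a) →-dec
      incidence? 1 (image (lookup (a ∷ b ∷ c ∷ [])))

-- The general argument takes the finite conditions as hypotheses, so it serves both graphs and
-- never unfolds an evaluated proof.
record Certificate (G : Graph (Fin (4 + n))) : Set where
  field
    {N r}     : ℕ
    hexagon   : Fin (suc N) → Fin 6 → Fin (4 + n)
    generator : Fin r → Fin (4 + n) → Fin (4 + n)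

  open Conditions G hexagon generator public

  field
    triangleFree         : TriangleFree G
    consecutive          : Consecutive
    generatorsInvolutive : GeneratorsInvolutive
    generatorsPreserve   : GeneratorsPreserve
    flip                 : Flip
    fan₁                 : Fan₁
    fan₂                 : Fan₂
    fan₃                 : Fan₃
    hexagonsInjective    : HexagonsInjective
    hexagonsPreserve     : HexagonsPreserve
    hexagonsReflect      : HexagonsReflect
    hexagonsDistinct     : HexagonsDistinct
    hexagonsComplete     : HexagonsComplete
    arcExtends           : ArcExtends
    edgeIncidence        : EdgeIncidence
    pathIncidence        : PathIncidence

-- Transitivity on arcs and ultrahomogeneity

module Homogeneity (G : Graph (Fin (4 + n))) (certificate : Certificate G) where

  open Certificate certificate

  generatorAut : Fin r → G ≅ G
  generatorAut g = involution G (generator g) (generatorsInvolutive g) (generatorsPreserve g)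

  -- Moves the requirement on the next vertex of an arc back to the base arc, where the fan
  -- conditions apply.
  pullback-adj : (α : G ≅ G) → ∀ {u a b} → to α u ≡ a → Adj G a b → Adj G u (from α b)
  pullback-adj α {u} {b = b} refl e = subst (λ x → Adj G x (from α b)) (from∘to α u) (from-adj α e)

  pullback-≢ : (α : G ≅ G) → ∀ {u a c} → to α u ≡ a → c ≢ a → from α c ≢ u
  pullback-≢ α {c = c} p c≢a eq = c≢a (trans (sym (to∘from α c)) (trans (cong (to α) eq) p))

  -- Induction along the path of consecutive vertices. If α maps `v₀` to i, then α⁻¹(i + 1) is a
  -- neighbour of `v₀`. The flip sends `v₀` to `v₁`, a generator from `fan₁` sends `v₁` to that
  -- neighbour, and α sends it on to i + 1.
  vertex-transitive : ∀ v → Σ[ α ∈ G ≅ G ] to α v₀ ≡ v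
  vertex-transitive = <-weakInduction (λ v → Σ[ α ∈ G ≅ G ] to α v₀ ≡ v)
    (involution G id (λ _ → refl) (λ _ _ → id) , refl)
    λ i (α , p) →
      let f , f₀ = flip
          g , _ , g₁ = fan₁ (from α (suc i)) (pullback-adj α p (consecutive i))
      in ≅-trans (generatorAut f) (≅-trans (generatorAut g) α) ,
         trans (cong (to α) (trans (cong (generator g) f₀) g₁)) (to∘from α (suc i))

  -- Preceding α by a generator that fixes `v₀` corrects the image of `v₁` without disturbing that
  -- of `v₀`. Longer arcs repeat this one vertex further on.
  arc₁-transitive : ∀ {a b} → Adj G a b → Σ[ α ∈ G ≅ G ] to α v₀ ≡ a × to α v₁ ≡ b
  arc₁-transitive {a} {b} ab =
    let α , p₀ = vertex-transitive a
        g , g₀ , g₁ = fan₁ (from α b) (pullback-adj α p₀ ab)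
    in ≅-trans (generatorAut g) α , trans (cong (to α) g₀) p₀ , trans (cong (to α) g₁) (to∘from α b)

  arc₂-transitive : ∀ {a b c} → Adj G a b → Adj G b c → c ≢ a →
                    Σ[ α ∈ G ≅ G ] to α v₀ ≡ a × to α v₁ ≡ b × to α v₂ ≡ c
  arc₂-transitive {c = c} ab bc c≢a =
    let α , p₀ , p₁ = arc₁-transitive ab
        g , g₀ , g₁ , g₂ = fan₂ (from α c) (pullback-adj α p₁ bc) (pullback-≢ α p₀ c≢a)
    in ≅-trans (generatorAut g) α , trans (cong (to α) g₀) p₀ , trans (cong (to α) g₁) p₁ ,
       trans (cong (to α) g₂) (to∘from α c)

  arc₃-transitive : ∀ {a b c d} → Adj G a b → Adj G b c → c ≢ a → Adj G c d → d ≢ b →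
                    Σ[ α ∈ G ≅ G ] to α v₀ ≡ a × to α v₁ ≡ b × to α v₂ ≡ c × to α v₃ ≡ d
  arc₃-transitive {d = d} ab bc c≢a cd d≢b =
    let α , p₀ , p₁ , p₂ = arc₂-transitive ab bc c≢a
        g , g₀ , g₁ , g₂ , g₃ = fan₃ (from α d) (pullback-adj α p₂ cd) (pullback-≢ α p₁ d≢b)
    in ≅-trans (generatorAut g) α , trans (cong (to α) g₀) p₀ , trans (cong (to α) g₁) p₁ ,
       trans (cong (to α) g₂) p₂ , trans (cong (to α) g₃) (to∘from α d)

  K₂-UH : UH G (K 2)
  K₂-UH = embeddings-transitive⇒UH G (lookup (v₀ ∷ v₁ ∷ [])) λ f emb →
    let α , p₀ , p₁ = arc₁-transitive (preserves emb {# 0} {# 1} λ ())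
    in α , λ { zero → p₀ ; (suc zero) → p₁ }

  P₃-UH : UH G (P 3)
  P₃-UH = embeddings-transitive⇒UH G (lookup (v₀ ∷ v₁ ∷ v₂ ∷ [])) λ f emb →
    let α , p₀ , p₁ , p₂ = arc₂-transitive (preserves emb P₃-edge₀₁) (preserves emb P₃-edge₁₂)
                                           (distinct emb (λ ()))
    in α , λ { zero → p₀ ; (suc zero) → p₁ ; (suc (suc zero)) → p₂ }

  module Walk {f : Fin 6 → Vertex} (emb : Embedding (C 6) G f) where

    step₀₁ : Adj G (f (# 0)) (f (# 1))
    step₀₁ = preserves emb (from-yes (adj? (C 6) (# 0) (# 1)))

    step₁₂ : Adj G (f (# 1)) (f (# 2))
    step₁₂ = preserves emb (from-yes (adj? (C 6) (# 1) (# 2)))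

    step₂₃ : Adj G (f (# 2)) (f (# 3))
    step₂₃ = preserves emb (from-yes (adj? (C 6) (# 2) (# 3)))

    step₃₄ : Adj G (f (# 3)) (f (# 4))
    step₃₄ = preserves emb (from-yes (adj? (C 6) (# 3) (# 4)))

    step₄₅ : Adj G (f (# 4)) (f (# 5))
    step₄₅ = preserves emb (from-yes (adj? (C 6) (# 4) (# 5)))

    step₅₀ : Adj G (f (# 5)) (f (# 0))
    step₅₀ = preserves emb (from-yes (adj? (C 6) (# 5) (# 0)))

  -- A hexagon is determined by any of its 3-arcs, so 3-arc-transitivity suffices.
  C₆-UH : UH G (C 6)
  C₆-UH = embeddings-transitive⇒UH G (hexagon zero) λ f emb →
    let open Walk emb
        α , p₀ , p₁ , p₂ , p₃ = arc₃-transitive step₀₁ step₁₂ (distinct emb (λ ()))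
                                                step₂₃ (distinct emb (λ ()))
    in α , extend emb α p₀ p₁ p₂ p₃
    where
    extend : ∀ {f} → Embedding (C 6) G f → (α : G ≅ G) →
             to α v₀ ≡ f (# 0) → to α v₁ ≡ f (# 1) → to α v₂ ≡ f (# 2) → to α v₃ ≡ f (# 3) →
             ∀ i → to α (hexagon zero i) ≡ f i
    extend {f} emb α p₀ p₁ p₂ p₃ i = trans (cong (to α) (sym base≡hexagon)) (base↦f i)
      where
      open Walk emb
      -- The last two vertices are pulled back along α, so that `base` closes the 3-arc 0123 to a
      -- hexagon; `arcExtends` identifies it with the first one listed.
      x = from α (f (# 4))
      y = from α (f (# 5))
      base = lookup (v₀ ∷ v₁ ∷ v₂ ∷ v₃ ∷ x ∷ y ∷ [])

      base≡hexagon : base i ≡ hexagon zero i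
      base≡hexagon = arcExtends x (pullback-adj α p₃ step₃₄) (pullback-≢ α p₂ (distinct emb (λ ())))
                                y (from-adj α step₄₅)
                                (symm G (pullback-adj α p₀ (symm G step₅₀))) i

      base↦f : ∀ i → to α (base i) ≡ f i
      base↦f zero                               = p₀
      base↦f (suc zero)                         = p₁
      base↦f (suc (suc zero))                   = p₂
      base↦f (suc (suc (suc zero)))             = p₃
      base↦f (suc (suc (suc (suc zero))))       = to∘from α _
      base↦f (suc (suc (suc (suc (suc zero))))) = to∘from α _

  -- The hexagons as a complete list of copies

  hex : Fin (suc N) → Subgraph G
  hex j = induced G (hexSet j)

  hex-IsInducedCopy : ∀ j → IsInducedCopy (C 6) (hex j)
  hex-IsInducedCopy j = image-IsInducedCopy G
    (record { injective = hexagonsInjective j _ _ ; preserves = hexagonsPreserve j _ _ })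
    (hexagonsReflect j)

  hex-distinct : ∀ {i j} → hex i ≈ hex j → i ≡ j
  hex-distinct = hexagonsDistinct _ _ ∘ proj₁

  hex-complete : ∀ S → IsInducedCopy (C 6) S → ∃[ j ] S ≈ hex j
  hex-complete S (ind , c) =
    -- Read in cyclic order, the copy is a closed walk as in `hexagonsComplete`. The image of
    -- `point` and that of the list of its six values agree by unfolding `any?`, so `eq` applies
    -- directly.
    let j , eq = hexagonsComplete _ _ step₀₁ _ step₁₂ (distinct emb (λ ())) _ step₂₃ (distinct emb (λ ()))
                   _ step₃₄ (distinct emb (λ ())) _ step₄₅ (distinct emb (λ ())) step₅₀
    in j , Induced⇒≈ {S = S} {hex j} ind (induced-Induced G _) (trans (vertices≡image S c) eq)
    where
    emb = point-embedding S c
    open Walk emb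

  -- Coherence relative to a pattern, an edge or a 2-path

  module _ {Q : Graph (Fin m)} (Q-UH : UH G Q)
           (reflects : ∀ f → Embedding Q G f → ∀ i j → Adj G (f i) (f j) → Adj Q i j)
           {ℓ : ℕ} (incidence : ∀ f → Embedding Q G f → Incidence ℓ (image f))
           {M : Subgraph (C 6)} (M-ind : Induced M) (M≅Q : IsCopy Q M) where

    module _ (H₀ M₀ : Subgraph G) (copy₀ : IsInducedCopy (C 6) H₀) (copyM : IsCopy ⟦ M ⟧ M₀)
             (M₀⊑H₀ : M₀ ⊑ H₀) where

      private
        copyQ : IsCopy Q M₀
        copyQ = ≅-trans copyM M≅Q

        emb : Embedding Q G (point M₀ copyQ)
        emb = point-embedding M₀ copyQ

        M₀-ind : Induced M₀
        M₀-ind = copy-Induced M₀ copyQ (reflects _ emb)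

        i : Fin (suc N)
        i = proj₁ (hex-complete H₀ copy₀)

        H₀≈hex : H₀ ≈ hex i
        H₀≈hex = proj₂ (hex-complete H₀ copy₀)

        counts : length (filter (through? (vertices M₀) i) (allFin (suc N))) ≡ ℓ ×
                 length (filter (meetsIn? (vertices M₀) i) (allFin (suc N))) ≡ 1
        counts = subst (Incidence ℓ) (sym (vertices≡image M₀ copyQ)) (incidence _ emb) i
          (subst (vertices M₀ ⊆_) (proj₁ H₀≈hex) (proj₁ M₀⊑H₀))

        other : ∀ {j} → j ≢ i → ¬ (hex j ≈ H₀)
        other {j} j≢i hex≈H₀ = j≢i (hex-distinct (≈-trans {S = hex j} {H₀} {hex i} hex≈H₀ H₀≈hex))

        other⁻ : ∀ {S j} → ¬ (S ≈ H₀) → S ≈ hex j → j ≢ i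
        other⁻ {S} S≉H₀ S≈hex refl =
          S≉H₀ (≈-trans {S = S} {hex i} {H₀} S≈hex (≈-sym {S = H₀} {hex i} H₀≈hex))

      -- All subgraphs involved are induced, so the intersection condition is an equality of vertex
      -- sets, in which `H₀` may be replaced by the listed hexagon `i`.
      meetingExactly : Exactly 1 (λ H₁ → IsInducedCopy (C 6) H₁ × ¬ (H₁ ≈ H₀) × (H₀ ⊓ H₁) ≈ M₀)
      meetingExactly = filtered-Exactly hex hex-distinct (meetsIn? (vertices M₀) i) (proj₂ counts)
        (λ j (j≢i , meet) → hex-IsInducedCopy j , other j≢i ,
          Induced⇒≈ {S = H₀ ⊓ hex j} {M₀} (Induced-⊓ {S = H₀} {hex j} (proj₁ copy₀) (induced-Induced G _)) M₀-ind
            (trans (cong (_∩ hexSet j) (proj₁ H₀≈hex)) meet))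
        (λ S (copyS , S≉H₀ , meet) →
          let j , S≈hex = hex-complete S copyS
          in j , (other⁻ {S} S≉H₀ S≈hex ,
                  trans (sym (cong₂ _∩_ (proj₁ H₀≈hex) (proj₁ S≈hex))) (proj₁ meet)) , S≈hex)

      throughExactly : Exactly ℓ (λ Hᵢ → IsInducedCopy (C 6) Hᵢ × ¬ (Hᵢ ≈ H₀) × M₀ ⊑ (Hᵢ ⊓ H₀))
      throughExactly = filtered-Exactly hex hex-distinct (through? (vertices M₀) i) (proj₁ counts)
        (λ j (j≢i , M₀⊆) → hex-IsInducedCopy j , other j≢i ,
          Induced⇒⊑ {S = M₀} {hex j ⊓ H₀} (Induced-⊓ {S = hex j} {H₀} (induced-Induced G _) (proj₁ copy₀))
            (λ v∈ → x∈p∩q⁺ (M₀⊆ v∈ , proj₁ M₀⊑H₀ v∈)))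
        (λ S (copyS , S≉H₀ , M₀⊑) →
          let j , S≈hex = hex-complete S copyS
          in j , (other⁻ {S} S≉H₀ S≈hex ,
                  λ v∈ → subst (_ ∈_) (proj₁ S≈hex) (proj₁ (x∈p∩q⁻ _ _ (proj₁ M₀⊑ v∈)))) , S≈hex)

      -- The hexagon meeting `H₀` in `M₀` alone contains `M₀`, so it occurs among the ℓ members. It
      -- is found there only up to `_≈_`, hence the intersection is recomputed from vertex sets.
      throughMeeting : ∃[ k ] (Exactly.member throughExactly k ⊓ H₀) ≈ M₀
      throughMeeting =
        let H₁ = Exactly.member meetingExactly zero
            copy₁ , H₁≉H₀ , meet = Exactly.sound meetingExactly zero
            H₁H₀≡M₀ = trans (∩-comm (vertices H₁) (vertices H₀)) (proj₁ meet)
            k , H₁≈ = Exactly.complete throughExactly H₁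
              (copy₁ , H₁≉H₀ ,
               Induced⇒⊑ {S = M₀} {H₁ ⊓ H₀} (Induced-⊓ {S = H₁} {H₀} (proj₁ copy₁) (proj₁ copy₀))
                 (⊆-reflexive (sym H₁H₀≡M₀)))
            Hₖ = Exactly.member throughExactly k
        in k , Induced⇒≈ {S = Hₖ ⊓ H₀} {M₀}
          (Induced-⊓ {S = Hₖ} {H₀} (proj₁ (proj₁ (Exactly.sound throughExactly k))) (proj₁ copy₀)) M₀-ind
          (trans (cong (_∩ vertices H₀) (sym (proj₁ H₁≈))) H₁H₀≡M₀)

    pattern-Coherent : Coherent G (C 6) ℓ M
    pattern-Coherent = record
      { relativelyUH = record
        { M-induced = M-ind
        ; M-UH      = UH-resp-≅ G M≅Q Q-UH
        ; H-UH      = C₆-UH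
        ; unique    = meetingExactly
        }
      ; coherent = λ H₀ M₀ copy₀ copyM M₀⊑H₀ →
          throughExactly H₀ M₀ copy₀ copyM M₀⊑H₀ , throughMeeting H₀ M₀ copy₀ copyM M₀⊑H₀
      }

  K₂-Coherent : {M : Subgraph (C 6)} → Induced M → IsCopy (K 2) M → Coherent G (C 6) 3 M
  K₂-Coherent = pattern-Coherent K₂-UH (λ _ _ → K₂-reflects {G = G})
    λ f emb → edgeIncidence _ _ (preserves emb {# 0} {# 1} λ ())

  P₃-Coherent : {M : Subgraph (C 6)} → Induced M → IsCopy (P 3) M → Coherent G (C 6) 1 M
  P₃-Coherent = pattern-Coherent P₃-UH (λ _ → P₃-reflects triangleFree)
    λ f emb → pathIncidence _ _ (preserves emb P₃-edge₀₁) _ (preserves emb P₃-edge₁₂) (distinct emb (λ ()))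

-- Deleting an end of a 2-path, and the descending chain

module _ {G : Graph (Fin n)} where

  infixl 5 _∖_

  remainingEdge? : (S : Subgraph G) (x u : Fin n) → Decidable (λ v → v ∈ edges S u × u ≢ x × v ≢ x)
  remainingEdge? S x u v = v ∈? edges S u ×-dec ¬? (u Fin.≟ x) ×-dec ¬? (v Fin.≟ x)

  _∖_ : Subgraph G → Fin n → Subgraph G
  S ∖ x = record
    { vertices   = vertices S - x
    ; edges      = λ u → select (remainingEdge? S x u)
    ; edges-sym  = λ e → let a , u≢x , v≢x = ∈-select⁻ (remainingEdge? S x _) e
                         in ∈-select⁺ (remainingEdge? S x _) (edges-sym S a , v≢x , u≢x)
    ; edges-adj  = λ e → edges-adj S (proj₁ (∈-select⁻ (remainingEdge? S x _) e))
    ; edges-ends = λ e → let a , u≢x , _ = ∈-select⁻ (remainingEdge? S x _) e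
                         in x∈p∧x≢y⇒x∈p-y (edges-ends S a) u≢x
    }

  ∖-DeletesVertex : (S : Subgraph G) {x : Fin n} → x ∈ vertices S → DeletesVertex S x (S ∖ x)
  ∖-DeletesVertex S x∈ = x∈ , refl , mk⇔ (∈-select⁻ (remainingEdge? S _ _)) (∈-select⁺ (remainingEdge? S _ _))

  -- The two vertices left, with indices 1 and 2, are adjacent in the path, as `K 2` asks of
  -- distinct vertices.
  P₃∖end≅K₂ : (S : Subgraph G) (c : IsCopy (P 3) S) → IsCopy (K 2) (S ∖ point S c zero)
  P₃∖end≅K₂ S c = copyOf (S ∖ x) (f ∘ suc) (suc-injective ∘ injective emb)
    (λ i → x∈p∧x≢y⇒x∈p-y (point∈ S c (suc i)) (suc≢ i))
    onto
    (mk⇔ (λ i≢j → ∈-select⁺ (remainingEdge? S x _)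
           (from-adj c (tail-adj _ _ i≢j) , suc≢ _ , suc≢ _))
         (λ e i≡j → irrefl G (cong (f ∘ suc) i≡j) (edges-adj (S ∖ x) e)))
    where
    f = point S c
    x = f zero
    emb = point-embedding S c

    suc≢ : ∀ i → f (suc i) ≢ x
    suc≢ i = distinct emb (λ ())

    tail-adj : ∀ (i j : Fin 2) → i ≢ j → Adj (P 3) (suc i) (suc j)
    tail-adj = from-yes (all? {2} λ i → all? {2} λ j → ¬? (i Fin.≟ j) →-dec adj? (P 3) (suc i) (suc j))

    onto : ∀ {v} → v ∈ vertices S - x → ∃[ i ] f (suc i) ≡ v
    onto v∈ with to c (_ , p─q⊆p _ _ v∈) | point-to S c (p─q⊆p _ _ v∈)
    ... | zero  | x≡v = contradiction (sym x≡v) (x∈p-y⇒x≢y (vertices S) v∈)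
    ... | suc i | eq  = i , eq

-- Here the hexagon is the ambient graph: with this, `P₃-reflects` makes `M` induced in it.
C₆-triangleFree : TriangleFree (C 6)
C₆-triangleFree = from-yes
  (all? λ u → all? λ v → adj? (C 6) u v →-dec all? λ w → adj? (C 6) v w →-dec ¬? (adj? (C 6) u w))

stronglyCoherent : (G : Graph (Fin (4 + n))) → Certificate G →
                   (M : Subgraph (C 6)) → IsCopy (P 3) M → StronglyCoherent G (C 6) M
stronglyCoherent G certificate M c = record
  { order>3   = s≤s (s≤s (s≤s (s≤s z≤n)))
  -- The chain is `M` followed by an edge; its two entries ask for 2 - 1 = 1 and 4 - 1 = 3 further
  -- hexagons.
  ; k         = 1
  ; chain     = chain
  ; first     = refl , λ _ → refl
  ; last      = edge
  ; connected = λ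
    { zero       → ≅-connected c (dominated-connected (P 3) (# 1)
                     (from-yes (all? λ u → (u Fin.≟ # 1) ⊎-dec adj? (P 3) u (# 1))))
    ; (suc zero) → ≅-connected edge (dominated-connected (K 2) (# 0)
                     (from-yes (all? λ u → (u Fin.≟ # 0) ⊎-dec adj? (K 2) u (# 0))))
    }
  ; deletion  = λ { zero → point M c zero , ∖-DeletesVertex M (point∈ M c zero) }
  ; coherent  = λ
    { zero       → P₃-Coherent (copy-Induced M c (P₃-reflects C₆-triangleFree (point-embedding M c))) c
    ; (suc zero) → K₂-Coherent (copy-Induced (chain (suc zero)) edge (K₂-reflects {G = C 6})) edge
    }
  }
  where
  open Homogeneity G certificate

  chain : Fin 2 → Subgraph (C 6)
  chain zero       = M
  chain (suc zero) = M ∖ point M c zero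

  edge : IsCopy (K 2) (chain (suc zero))
  edge = P₃∖end≅K₂ M c

-- Tables for the Pappus and Desargues graphs

table : Vec ℕ m → Fin m → Fin (suc n)
table xs i = lookup xs i mod suc _

-- Both graphs consist of a Hamiltonian cycle and one chord at each vertex. The slots are successor,
-- predecessor (adding `n` subtracts 1 modulo n + 1) and the other end of the chord.
chordNbr : Vec ℕ (suc n) → Fin (suc n) → Fin 3 → Fin (suc n)
chordNbr {n} chords u = lookup (suc (toℕ u) mod suc n ∷ (toℕ u + n) mod suc n ∷ table chords u ∷ [])

module Pappus where

  nbr : Fin 18 → Fin 3 → Fin 18
  nbr = chordNbr (13 ∷ 6 ∷ 9 ∷ 14 ∷ 11 ∷ 16 ∷ 1 ∷ 12 ∷ 15 ∷ 2 ∷ 17 ∷ 4 ∷ 7 ∷ 0 ∷ 3 ∷ 8 ∷ 5 ∷ 10 ∷ [])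

  neighbours : Neighbours 𝒫
  neighbours = record
    { nbr     = nbr
    -- The edge list of `𝒫` is searched only in these two checks; later decisions read the table.
    ; nbr-adj = from-yes (all? λ u → all? λ k → adj? 𝒫 u (nbr u k))
    ; adj-nbr = from-yes (all? λ u → all? λ v → adj? 𝒫 u v →-dec any? λ k → nbr u k Fin.≟ v)
    }

  -- With four hexagons on each of the 27 edges there are 27 · 4 / 6 = 18. They are listed
  -- lexicographically, each from its least vertex, which puts the one through 0, 1, 2, 3 first, as
  -- `arcExtends` demands.
  hexagon : Fin 18 → Fin 6 → Fin 18
  hexagon j = table (lookup (
    ( 0 ∷  1 ∷  2 ∷  3 ∷ 14 ∷ 13 ∷ []) ∷ ( 0 ∷  1 ∷  2 ∷  9 ∷ 10 ∷ 17 ∷ []) ∷ ( 0 ∷  1 ∷  6 ∷  5 ∷ 16 ∷ 17 ∷ []) ∷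
    ( 0 ∷  1 ∷  6 ∷  7 ∷ 12 ∷ 13 ∷ []) ∷ ( 0 ∷ 13 ∷ 12 ∷ 11 ∷ 10 ∷ 17 ∷ []) ∷ ( 0 ∷ 13 ∷ 14 ∷ 15 ∷ 16 ∷ 17 ∷ []) ∷
    ( 1 ∷  2 ∷  3 ∷  4 ∷  5 ∷  6 ∷ []) ∷ ( 1 ∷  2 ∷  9 ∷  8 ∷  7 ∷  6 ∷ []) ∷ ( 2 ∷  3 ∷  4 ∷ 11 ∷ 10 ∷  9 ∷ []) ∷
    ( 2 ∷  3 ∷ 14 ∷ 15 ∷  8 ∷  9 ∷ []) ∷ ( 3 ∷  4 ∷  5 ∷ 16 ∷ 15 ∷ 14 ∷ []) ∷ ( 3 ∷  4 ∷ 11 ∷ 12 ∷ 13 ∷ 14 ∷ []) ∷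
    ( 4 ∷  5 ∷  6 ∷  7 ∷ 12 ∷ 11 ∷ []) ∷ ( 4 ∷  5 ∷ 16 ∷ 17 ∷ 10 ∷ 11 ∷ []) ∷ ( 5 ∷  6 ∷  7 ∷  8 ∷ 15 ∷ 16 ∷ []) ∷
    ( 7 ∷  8 ∷  9 ∷ 10 ∷ 11 ∷ 12 ∷ []) ∷ ( 7 ∷  8 ∷ 15 ∷ 14 ∷ 13 ∷ 12 ∷ []) ∷ ( 8 ∷  9 ∷ 10 ∷ 17 ∷ 16 ∷ 15 ∷ []) ∷ []) j)

  -- Besides the identity: a flip of the edge 01, then involutions moving 1, 1, 2, 3
  -- that fix the vertices preceding the moved one on the arc 0123.
  generator : Fin 6 → Fin 18 → Fin 18
  generator = lookup (id ∷ Vec.map table (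
    ( 1 ∷  0 ∷ 17 ∷ 16 ∷ 15 ∷ 14 ∷ 13 ∷ 12 ∷ 11 ∷ 10 ∷  9 ∷  8 ∷  7 ∷  6 ∷  5 ∷  4 ∷  3 ∷  2 ∷ []) ∷
    ( 0 ∷ 13 ∷ 14 ∷  3 ∷  4 ∷ 11 ∷ 12 ∷  7 ∷  8 ∷ 15 ∷ 16 ∷  5 ∷  6 ∷  1 ∷  2 ∷  9 ∷ 10 ∷ 17 ∷ []) ∷
    ( 0 ∷ 17 ∷ 16 ∷ 15 ∷  8 ∷  9 ∷ 10 ∷ 11 ∷  4 ∷  5 ∷  6 ∷  7 ∷ 12 ∷ 13 ∷ 14 ∷  3 ∷  2 ∷  1 ∷ []) ∷
    ( 0 ∷  1 ∷  6 ∷  5 ∷  4 ∷  3 ∷  2 ∷  9 ∷  8 ∷  7 ∷ 12 ∷ 11 ∷ 10 ∷ 17 ∷ 16 ∷ 15 ∷ 14 ∷ 13 ∷ []) ∷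
    ( 0 ∷  1 ∷  2 ∷  9 ∷  8 ∷  7 ∷  6 ∷  5 ∷  4 ∷  3 ∷ 14 ∷ 15 ∷ 16 ∷ 17 ∷ 10 ∷ 11 ∷ 12 ∷ 13 ∷ []) ∷ []))

  open Conditions.Deciders 𝒫 hexagon generator neighbours

  certificate : Certificate 𝒫
  certificate = record
    { hexagon              = hexagon
    ; generator            = generator
    ; triangleFree         = from-yes triangleFree?
    ; consecutive          = from-yes consecutive?
    ; generatorsInvolutive = from-yes generatorsInvolutive?
    ; generatorsPreserve   = from-yes generatorsPreserve?
    ; flip                 = from-yes flip?
    ; fan₁                 = from-yes fan₁?
    ; fan₂                 = from-yes fan₂?
    ; fan₃                 = from-yes fan₃?
    ; hexagonsInjective    = from-yes hexagonsInjective?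
    ; hexagonsPreserve     = from-yes hexagonsPreserve?
    ; hexagonsReflect      = from-yes hexagonsReflect?
    ; hexagonsDistinct     = from-yes hexagonsDistinct?
    ; hexagonsComplete     = from-yes hexagonsComplete?
    ; arcExtends           = from-yes arcExtends?
    ; edgeIncidence        = from-yes edgeIncidence?
    ; pathIncidence        = from-yes pathIncidence?
    }

module Desargues where

  nbr : Fin 20 → Fin 3 → Fin 20
  nbr = chordNbr (15 ∷ 10 ∷ 13 ∷ 8 ∷ 19 ∷ 14 ∷ 17 ∷ 12 ∷ 3 ∷ 18 ∷ 1 ∷ 16 ∷ 7 ∷ 2 ∷ 5 ∷ 0 ∷ 11 ∷ 6 ∷ 9 ∷ 4 ∷ [])

  neighbours : Neighbours 𝒟
  neighbours = record
    { nbr     = nbr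
    ; nbr-adj = from-yes (all? λ u → all? λ k → adj? 𝒟 u (nbr u k))
    ; adj-nbr = from-yes (all? λ u → all? λ v → adj? 𝒟 u v →-dec any? λ k → nbr u k Fin.≟ v)
    }

  -- Here the count is 30 · 4 / 6 = 20, and the order is again lexicographic.
  hexagon : Fin 20 → Fin 6 → Fin 20
  hexagon j = table (lookup (
    ( 0 ∷  1 ∷  2 ∷  3 ∷  4 ∷ 19 ∷ []) ∷ ( 0 ∷  1 ∷  2 ∷ 13 ∷ 14 ∷ 15 ∷ []) ∷ ( 0 ∷  1 ∷ 10 ∷  9 ∷ 18 ∷ 19 ∷ []) ∷
    ( 0 ∷  1 ∷ 10 ∷ 11 ∷ 16 ∷ 15 ∷ []) ∷ ( 0 ∷ 15 ∷ 14 ∷  5 ∷  4 ∷ 19 ∷ []) ∷ ( 0 ∷ 15 ∷ 16 ∷ 17 ∷ 18 ∷ 19 ∷ []) ∷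
    ( 1 ∷  2 ∷  3 ∷  8 ∷  9 ∷ 10 ∷ []) ∷ ( 1 ∷  2 ∷ 13 ∷ 12 ∷ 11 ∷ 10 ∷ []) ∷ ( 2 ∷  3 ∷  4 ∷  5 ∷ 14 ∷ 13 ∷ []) ∷
    ( 2 ∷  3 ∷  8 ∷  7 ∷ 12 ∷ 13 ∷ []) ∷ ( 3 ∷  4 ∷  5 ∷  6 ∷  7 ∷  8 ∷ []) ∷ ( 3 ∷  4 ∷ 19 ∷ 18 ∷  9 ∷  8 ∷ []) ∷
    ( 4 ∷  5 ∷  6 ∷ 17 ∷ 18 ∷ 19 ∷ []) ∷ ( 5 ∷  6 ∷  7 ∷ 12 ∷ 13 ∷ 14 ∷ []) ∷ ( 5 ∷  6 ∷ 17 ∷ 16 ∷ 15 ∷ 14 ∷ []) ∷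
    ( 6 ∷  7 ∷  8 ∷  9 ∷ 18 ∷ 17 ∷ []) ∷ ( 6 ∷  7 ∷ 12 ∷ 11 ∷ 16 ∷ 17 ∷ []) ∷ ( 7 ∷  8 ∷  9 ∷ 10 ∷ 11 ∷ 12 ∷ []) ∷
    ( 9 ∷ 10 ∷ 11 ∷ 16 ∷ 17 ∷ 18 ∷ []) ∷ (11 ∷ 12 ∷ 13 ∷ 14 ∷ 15 ∷ 16 ∷ []) ∷ []) j)

  -- After the identity and a flip of the edge 01 come involutions sending 1 to 15, 1 to 19, 2 to 10
  -- and 3 to 13, each fixing the earlier vertices of the arc 0123. With the identity these reach
  -- every continuation in the three fans.
  generator : Fin 6 → Fin 20 → Fin 20
  generator = lookup (id ∷ Vec.map table (
    ( 1 ∷  0 ∷ 19 ∷  4 ∷  3 ∷  8 ∷  7 ∷  6 ∷  5 ∷ 14 ∷ 15 ∷ 16 ∷ 17 ∷ 18 ∷  9 ∷ 10 ∷ 11 ∷ 12 ∷ 13 ∷  2 ∷ []) ∷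
    ( 0 ∷ 15 ∷ 14 ∷  5 ∷  4 ∷  3 ∷  8 ∷  7 ∷  6 ∷ 17 ∷ 16 ∷ 11 ∷ 12 ∷ 13 ∷  2 ∷  1 ∷ 10 ∷  9 ∷ 18 ∷ 19 ∷ []) ∷
    ( 0 ∷ 19 ∷  4 ∷  3 ∷  2 ∷ 13 ∷ 12 ∷  7 ∷  8 ∷  9 ∷ 18 ∷ 17 ∷  6 ∷  5 ∷ 14 ∷ 15 ∷ 16 ∷ 11 ∷ 10 ∷  1 ∷ []) ∷
    ( 0 ∷  1 ∷ 10 ∷  9 ∷ 18 ∷ 17 ∷  6 ∷  7 ∷  8 ∷  3 ∷  2 ∷ 13 ∷ 12 ∷ 11 ∷ 16 ∷ 15 ∷ 14 ∷  5 ∷  4 ∷ 19 ∷ []) ∷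
    ( 0 ∷  1 ∷  2 ∷ 13 ∷ 14 ∷  5 ∷  6 ∷  7 ∷ 12 ∷ 11 ∷ 10 ∷  9 ∷  8 ∷  3 ∷  4 ∷ 19 ∷ 18 ∷ 17 ∷ 16 ∷ 15 ∷ []) ∷ []))

  open Conditions.Deciders 𝒟 hexagon generator neighbours

  certificate : Certificate 𝒟
  certificate = record
    { hexagon              = hexagon
    ; generator            = generator
    ; triangleFree         = from-yes triangleFree?
    ; consecutive          = from-yes consecutive?
    ; generatorsInvolutive = from-yes generatorsInvolutive?
    ; generatorsPreserve   = from-yes generatorsPreserve?
    ; flip                 = from-yes flip?
    ; fan₁                 = from-yes fan₁?
    ; fan₂                 = from-yes fan₂?
    ; fan₃                 = from-yes fan₃?
    ; hexagonsInjective    = from-yes hexagonsInjective?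
    ; hexagonsPreserve     = from-yes hexagonsPreserve?
    ; hexagonsReflect      = from-yes hexagonsReflect?
    ; hexagonsDistinct     = from-yes hexagonsDistinct?
    ; hexagonsComplete     = from-yes hexagonsComplete?
    ; arcExtends           = from-yes arcExtends?
    ; edgeIncidence        = from-yes edgeIncidence?
    ; pathIncidence        = from-yes pathIncidence?
    }

theorem1 : (M : Subgraph (C 6)) → IsCopy (P 3) M →
    StronglyCoherent 𝒫 (C 6) M × StronglyCoherent 𝒟 (C 6) M
theorem1 M c = stronglyCoherent 𝒫 Pappus.certificate M c , stronglyCoherent 𝒟 Desargues.certificate M c
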